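{- There exist $d\ge 1$ and, for every $n$, a Boolean function $F:\mathbb{F}_2^n\to\{0,1/2\}\subseteq\mathbb{T}$ such that for every classical polynomial $P$ of degree at most $d$, $$\Pr_{x\sim\mathbb{F}_2^n}[F(x)=P(x)] \le \frac12 + o(1),$$ but there is a non-classical polynomial $P'$ of degree $d'\le d$ satisfying $$\Pr_{x\sim\mathbb{F}_2^n}[F(x)=P'(x)] \ge \frac12 + \Omega(1),$$ where $o(1)$ tends to $0$ as $n\to\infty$ and $\Omega(1)$ is bounded below by a positive constant independent of $n$.
   Context: $\mathbb{T}=\mathbb{R}/\mathbb{Z}$. A Boolean function is identified with a map $\mathbb{F}_2^n\to\{0,1/2\}\subseteq\mathbb{T}$. A non-classical polynomial of degree $\le d$ is a function $F:\mathbb{F}_2^n\to\mathbb{T}$ of the form $F(x)=\alpha+\sum \frac{c_{e_1,\dots,e_n,k}\,x_1^{e_1}\cdots x_n^{e_n}}{2^k} \bmod 1$, the sum over $0\le e_1,\dots,e_n\le1$ and $k\ge1$ with $\sum_i e_i+(k-1)\le d$, where $\alpha\in\mathbb{T}$ (the shift) and $c_{e_1,\dots,e_n,k}\in\{0,1\}$; the depth is the largest $k$ with some $c_{e,k}\ne0$. Only polynomials whose shift is of the form $A/2^k$ with $k$ the depth and $A\in\{0,\dots,2^k-1\}$ are considered. Classical polynomials are non-classical polynomials with shift in $\{0,1/2\}$ and depth $1$. Uniform $x$ in probabilities. -}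

module Defs where

open import Data.Nat using (ℕ; zero; suc; _+_; _*_; _∸_; _^_; _≤_; _<_; _%_)
open import Data.Bool using (Bool; true; false; if_then_else_; _∧_)
open import Data.Vec using (Vec; []; _∷_)
open import Data.List using (List; []; _∷_; map; length; filterᵇ; upTo; concatMap)
open import Data.Nat.ListAction using (sum)
open import Data.Nat.Properties using (m^n≢0)
open import Data.Fin.Subset using (Subset; ∣_∣)
open import Data.Product using (Σ; _×_; _,_)
open import Data.Sum using (_⊎_)
open import Relation.Binary.PropositionalEquality using (_≡_)
open import Data.Nat using (_≡ᵇ_)

-- Points of F₂ⁿ are Boolean vectors (false = 0, true = 1).
Point : ℕ → Set
Point n = Vec Bool n

allPoints : (n : ℕ) → List (Point n)
allPoints zero = [] ∷ []
allPoints (suc n) = concatMap (λ v → (false ∷ v) ∷ (true ∷ v) ∷ []) (allPoints n)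

-- A Boolean function F₂ⁿ → {0, 1/2} ⊆ 𝕋 (true ↦ 1/2, false ↦ 0).
BoolFun : ℕ → Set
BoolFun n = Point n → Bool

mono : ∀ {n} → Subset n → Point n → ℕ
mono [] [] = 1
mono (s ∷ S) (x ∷ X) = (if s then (if x then 1 else 0) else 1) * mono S X

-- Elements of 𝕋 of the form a / 2^k (mod 1), stored as (a , k).
Dyadic : Set
Dyadic = ℕ × ℕ

-- Equality in 𝕋 = ℝ/ℤ:  a/2^k ≡ b/2^l (mod 1)  iff  a·2^l ≡ b·2^k (mod 2^(k+l)).
eqT : Dyadic → Dyadic → Bool
eqT (a , k) (b , l) = (_%_ (a * 2 ^ l) (2 ^ (k + l)) {{m^n≢0 2 (k + l)}}) ≡ᵇ (_%_ (b * 2 ^ k) (2 ^ (k + l)) {{m^n≢0 2 (k + l)}})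

boolT : Bool → Dyadic
boolT b = (if b then 1 else 0) , 1

-- A non-classical polynomial on F₂ⁿ of degree ≤ d:
--   F(x) = shift/2^depth + Σ_{S,k} coeff S k · x^S / 2^k  (mod 1)
-- with coeff S k ∈ {0,1}, nonzero only for 1 ≤ k and |S| + (k-1) ≤ d,
-- depth = the largest k with some coeff S k nonzero (0 if there is none),
-- and shift A ∈ {0,…,2^depth − 1}.
record NCPoly (n d : ℕ) : Set where
  field
    depth      : ℕ
    shift      : ℕ
    shift<     : shift < 2 ^ depth
    coeff      : Subset n → ℕ → Bool
    coeffRange : ∀ S k → coeff S k ≡ true → 1 ≤ k × k ≤ depth
    coeffDeg   : ∀ S k → coeff S k ≡ true → ∣ S ∣ + (k ∸ 1) ≤ d
    depthExact : depth ≡ 0 ⊎ Σ (Subset n) (λ S → coeff S depth ≡ true)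

open NCPoly public

evalP : ∀ {n d} → NCPoly n d → Point n → Dyadic
evalP {n} P x =
  (shift P + sum (map (λ S → sum (map (λ k →
      if coeff P S k then mono S x * 2 ^ (depth P ∸ k) else 0)
      (map suc (upTo (depth P))))) (allPoints n)))
  , depth P

-- Classical polynomials: depth ≤ 1 (so shift ∈ {0,1/2}, all coefficients at level 1/2).
Classical : ∀ {n d} → NCPoly n d → Set
Classical P = depth P ≤ 1

-- #{x ∈ F₂ⁿ : F(x) = P(x)}; Pr[F = P] = agree F P / 2ⁿ.
agree : ∀ {n d} → BoolFun n → NCPoly n d → ℕ
agree {n} F P = length (filterᵇ (λ x → eqT (boolT (F x)) (evalP P x)) (allPoints n))

{-# OPTIONS --safe #-}
module Submission where

open import Defs
open import Algebra.Bundles using (CommutativeRing)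
open import Algebra.Properties.CommutativeSemigroup using (interchange)
open import Data.Bool using (Bool; true; false; not; _∧_; _xor_; if_then_else_; _≟_)
open import Data.Bool.Properties using (¬-not; not-involutive; ∧-identityʳ; ∧-zeroʳ; xor-same; xor-assoc; xor-identityʳ; not-distribˡ-xor; xor-∧-commutativeRing)
open import Data.Fin.Subset using (Subset; ∣_∣; _⊆_; ⊤)
open import Data.Fin.Subset.Properties using (⊆-refl; ⊆-trans; drop-∷-⊆; out⊆; in⊆in; ∣⊤∣≡n)
open import Data.List using (List; []; _∷_; map; length; filterᵇ; concatMap; upTo)
open import Data.Nat using (ℕ; zero; suc; _+_; _*_; _^_; _∸_; _/_; _%_; _⊔_; _≤_; _<_; s≤s; z≤n; _≡ᵇ_)
open import Data.Nat.Combinatorics using (_C_; nCk+nC[k+1]≡[n+1]C[k+1])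
open import Data.Nat.DivMod using (m/n≡1+[m∸n]/n; m%n*o≡m*o%[n*o]; %-distribˡ-+)
open import Data.Nat.ListAction using (sum)
open import Data.Nat.Properties hiding (_≟_)
open import Data.Nat.Tactic.RingSolver using (solve-∀)
open import Data.Product using (Σ; _×_; _,_; proj₁; proj₂)
open import Data.Sum using (_⊎_; inj₁; inj₂)
open import Data.Vec using ([]; _∷_; here)
open import Function using (_∘_)
open import Relation.Binary.PropositionalEquality
open import Relation.Nullary using (contradiction; yes; no)
open import Relation.Nullary.Decidable using (toWitness)
import Data.Nat as ℕ

-- Write w = |x|.  Take d = 14 and let F(x) be bit 4 of w.  The non-classical polynomial C(w,12)/8 has
-- degree 12 + 2, and C(w,12) ≡ 4·(bit 4 of w) mod 8 holds for 36 of the 64 residues w mod 64; since w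
-- equidistributes mod 64, the agreement tends to 36/64 > 1/2.
--
-- A classical polynomial Q of degree < 16 is treated one degree at a time (Alon-Beigel): Ramsey's
-- theorem yields many variables on which all coefficients of top degree d coincide.  Fixing the other
-- variables, the top part becomes a multiple of C(w,d) mod 2, which is 16-periodic in w because
-- d < 16, so adding it to F keeps F antiperiodic (f(16 + w) = not f(w)).  In the end Q is
-- constant, and equidistribution of w mod 32 shows that an antiperiodic function is nearly balanced.

-- Equidistribution of binomial sums

+-interchange : ∀ u v w x → u + v + (w + x) ≡ u + w + (v + x)
+-interchange = solve-∀

+-swap : ∀ u v w → u + (v + w) ≡ v + (u + w)
+-swap = solve-∀

double : ∀ x y → x * y + x * y ≡ x * (2 * y)
double = solve-∀

-- The sum of `g (s + i)` with weights `n C i`, that is, of `g (∣ x ∣ + s)` over the `n`-cube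
-- (`cubeSum-weight`). The shift `s` turns Pascal's rule into the recursion.
walk : (ℕ → ℕ) → ℕ → ℕ → ℕ
walk g zero s = g s
walk g (suc n) s = walk g n s + walk g n (suc s)

window : (ℕ → ℕ) → ℕ → ℕ → ℕ
window a zero s = 0
window a (suc l) s = window a l s + a (l + s)

walk-+ : ∀ g l n s → walk g (l + n) s ≡ walk (walk g n) l s
walk-+ g zero n s = refl
walk-+ g (suc l) n s = cong₂ _+_ (walk-+ g l n s) (walk-+ g l n (suc s))

walk-* : ∀ c g n s → walk (λ t → c * g t) n s ≡ c * walk g n s
walk-* c g zero s = refl
walk-* c g (suc n) s = trans (cong₂ _+_ (walk-* c g n s) (walk-* c g n (suc s))) (sym (*-distribˡ-+ c _ _))

window-* : ∀ c a l s → window (λ t → c * a t) l s ≡ c * window a l s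
window-* c a zero s = sym (*-zeroʳ c)
window-* c a (suc l) s = trans (cong (_+ c * a (l + s)) (window-* c a l s)) (sym (*-distribˡ-+ c _ _))

window-sum : ∀ a l s → window (λ t → a t + a (suc t)) l s ≡ window a l s + window a l (suc s)
window-sum a zero s = refl
window-sum a (suc l) s rewrite window-sum a l s | +-suc l s =
  +-interchange (window a l s) (window a l (suc s)) (a (l + s)) (a (suc (l + s)))

window-walk : ∀ g l κ → (∀ s → window g l s ≡ κ) → ∀ n s → window (walk g n) l s ≡ κ * 2 ^ n
window-walk g l κ h zero s = trans (h s) (sym (*-identityʳ κ))
window-walk g l κ h (suc n) s = begin
  window (walk g (suc n)) l s                         ≡⟨ window-sum (walk g n) l s ⟩
  window (walk g n) l s + window (walk g n) l (suc s) ≡⟨ cong₂ _+_ (window-walk g l κ h n s) (window-walk g l κ h n (suc s)) ⟩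
  κ * 2 ^ n + κ * 2 ^ n                               ≡⟨ double κ (2 ^ n) ⟩
  κ * 2 ^ suc n                                       ∎
  where
  open ≡-Reasoning

-- offPath l = 2 ^ l ∸ 1 and offChain l = 2 ^ l ∸ suc l: the numbers of points of the l-cube
-- other than its top, resp. outside a maximal chain.
offPath : ℕ → ℕ
offPath zero = 0
offPath (suc l) = 2 ^ l + offPath l

offChain : ℕ → ℕ
offChain zero = 0
offChain (suc l) = offChain l + offPath l

suc-offPath : ∀ l → suc (offPath l) ≡ 2 ^ l
suc-offPath zero = refl
suc-offPath (suc l) = begin
  suc (2 ^ l + offPath l) ≡⟨ +-suc (2 ^ l) (offPath l) ⟨
  2 ^ l + suc (offPath l) ≡⟨ cong (2 ^ l +_) (trans (suc-offPath l) (sym (+-identityʳ _))) ⟩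
  2 ^ suc l               ∎
  where open ≡-Reasoning

offChain+suc : ∀ l → offChain l + suc l ≡ 2 ^ l
offChain+suc zero = refl
offChain+suc (suc l) = begin
  offChain l + offPath l + suc (suc l)   ≡⟨ regroup (offChain l) (offPath l) (suc l) ⟩
  offChain l + suc l + suc (offPath l)   ≡⟨ cong₂ _+_ (offChain+suc l) (trans (suc-offPath l) (sym (+-identityʳ _))) ⟩
  2 ^ suc l                              ∎
  where
  open ≡-Reasoning
  regroup : ∀ x y z → x + y + suc z ≡ x + z + suc y
  regroup = solve-∀

module _ (a : ℕ → ℕ) (Y δ : ℕ) (lower : ∀ t → Y ≤ a t + δ) where

  walk-lower : ∀ l s → 2 ^ l * Y ≤ walk a l s + 2 ^ l * δ
  walk-lower zero s = subst₂ (λ y d → y ≤ a s + d) (sym (*-identityˡ Y)) (sym (*-identityˡ δ)) (lower s)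
  walk-lower (suc l) s = subst₂ _≤_ (lhs (2 ^ l) Y) (rhs (walk a l s) (walk a l (suc s)) (2 ^ l) δ)
    (+-mono-≤ (walk-lower l s) (walk-lower l (suc s)))
    where
    lhs : ∀ p y → p * y + p * y ≡ 2 * p * y
    lhs = solve-∀
    rhs : ∀ u v p d → u + p * d + (v + p * d) ≡ u + v + 2 * p * d
    rhs = solve-∀

  -- The top point of the `l`-cube keeps its exact value; only the other `offPath l` points are
  -- estimated by `lower`. Errors stand on the right to avoid truncated subtraction.
  walk-top : ∀ l s → a (l + s) + offPath l * Y ≤ walk a l s + offPath l * δ
  walk-top zero s = ≤-refl
  walk-top (suc l) s = subst₂ _≤_
    (trans (lhs (2 ^ l) Y (a (l + suc s)) (offPath l)) (cong (λ t → a t + offPath (suc l) * Y) (+-suc l s)))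
    (rhs (walk a l s) (walk a l (suc s)) (2 ^ l) (offPath l) δ)
    (+-mono-≤ (walk-lower l s) (walk-top l (suc s)))
    where
    lhs : ∀ p y x e → p * y + (x + e * y) ≡ x + (p + e) * y
    lhs = solve-∀
    rhs : ∀ u v p e d → u + p * d + (v + e * d) ≡ u + v + (p + e) * d
    rhs = solve-∀

  -- The window collects the values of a along a maximal chain of the l-cube.
  walk-window : ∀ l s → window a (suc l) s + offChain l * Y ≤ walk a l s + offChain l * δ
  walk-window zero s = ≤-refl
  walk-window (suc l) s = subst₂ _≤_
    (trans (lhs (window a (suc l) s) (offChain l) Y (a (l + suc s)) (offPath l))
           (cong (λ t → window a (suc l) s + a t + offChain (suc l) * Y) (+-suc l s)))
    (rhs (walk a l s) (walk a l (suc s)) (offChain l) (offPath l) δ)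
    (+-mono-≤ (walk-window l s) (walk-top l (suc s)))
    where
    lhs : ∀ w j y x e → w + j * y + (x + e * y) ≡ w + x + (j + e) * y
    lhs = solve-∀
    rhs : ∀ u v j e d → u + j * d + (v + e * d) ≡ u + v + (j + e) * d
    rhs = solve-∀

module _ (g : ℕ → ℕ) (l κ : ℕ) (window-const : ∀ s → window g (suc l) s ≡ κ) where

  -- By `window-walk` the values of `walk g n` at `suc l` consecutive shifts add up to exactly
  -- `κ * 2 ^ n`, so `δ` measures how far one value lies below the mean. Uniformity in `s` lets the
  -- bound serve again as the hypothesis `lower`.
  LowerBound : ℕ → ℕ → Set
  LowerBound n δ = ∀ s → κ * 2 ^ n ≤ suc l * walk g n s + δ

  lowerBound-suc : ∀ n δ → LowerBound n δ → LowerBound (suc n) (2 * δ)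
  lowerBound-suc n δ h s = subst₂ _≤_ (double κ (2 ^ n)) (rhs (suc l) (walk g n s) (walk g n (suc s)) δ)
    (+-mono-≤ (h s) (h (suc s)))
    where
    rhs : ∀ m u v d → m * u + d + (m * v + d) ≡ m * (u + v) + 2 * d
    rhs = solve-∀

  lowerBound-+ : ∀ r n δ → LowerBound n δ → LowerBound (r + n) (2 ^ r * δ)
  lowerBound-+ zero n δ h = subst (LowerBound n) (sym (*-identityˡ _)) h
  lowerBound-+ (suc r) n δ h =
    subst (LowerBound (suc r + n)) (sym (*-assoc 2 (2 ^ r) δ)) (lowerBound-suc (r + n) (2 ^ r * δ) (lowerBound-+ r n δ h))

  -- l more steps shrink the relative error by the factor offChain l / 2 ^ l < 1.
  lowerBound-contract : ∀ n δ → LowerBound n δ → LowerBound (l + n) (offChain l * δ)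
  lowerBound-contract n δ h s = begin
    κ * 2 ^ (l + n)                                 ≡⟨ total ⟩
    suc l * Y + offChain l * Y                      ≡⟨ cong (_+ offChain l * Y) chain ⟨
    window a (suc l) s + offChain l * Y             ≤⟨ walk-window a Y δ h l s ⟩
    walk a l s + offChain l * δ                     ≡⟨ cong (_+ offChain l * δ) cube ⟩
    suc l * walk g (l + n) s + offChain l * δ       ∎
    where
    open ≤-Reasoning
    Y = κ * 2 ^ n
    a : ℕ → ℕ
    a t = suc l * walk g n t
    total : κ * 2 ^ (l + n) ≡ suc l * Y + offChain l * Y
    total = trans (cong (κ *_) (trans (^-distribˡ-+-* 2 l n) (cong (_* 2 ^ n) (sym (offChain+suc l)))))
                  (distr κ (offChain l) (suc l) (2 ^ n))
      where
      distr : ∀ c j m p → c * ((j + m) * p) ≡ m * (c * p) + j * (c * p)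
      distr = solve-∀
    -- The chain carries a full window, whose sum is known exactly; only the `offChain l` points off
    -- it contribute to the new error.
    chain : window a (suc l) s ≡ suc l * Y
    chain = trans (window-* (suc l) (walk g n) (suc l) s)
                  (cong (suc l *_) (window-walk g (suc l) κ window-const n s))
    cube : walk a l s ≡ suc l * walk g (l + n) s
    cube = trans (walk-* (suc l) (walk g n) l s) (cong (suc l *_) (sym (walk-+ g l n s)))

  lowerBound-iterate : ∀ k → LowerBound (k * l) (offChain l ^ k * κ)
  lowerBound-iterate zero s = ≤-trans (≤-reflexive (*-comm κ 1)) (m≤n+m (1 * κ) (suc l * g s))
  lowerBound-iterate (suc k) = subst (LowerBound (suc k * l)) (sym (*-assoc (offChain l) _ κ))
    (lowerBound-contract (k * l) (offChain l ^ k * κ) (lowerBound-iterate k))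

-- Bernoulli's inequality `(1 + 1/j) ^ k ≥ 1 + k/j` with denominators cleared.
bernoulli : ∀ j k → j ^ k * (j + k) ≤ suc j ^ k * j
bernoulli j zero = ≤-reflexive (cong (_+ 0) (+-identityʳ j))
bernoulli j (suc k) = begin
  j * j ^ k * (j + suc k)                 ≡⟨ cong (λ t → j * j ^ k * t) (+-suc j k) ⟩
  j * j ^ k * suc (j + k)                 ≤⟨ m≤m+n _ (j ^ k * k) ⟩
  j * j ^ k * suc (j + k) + j ^ k * k     ≡⟨ lhs j (j ^ k) k ⟩
  suc j * (j ^ k * (j + k))               ≤⟨ *-monoʳ-≤ (suc j) (bernoulli j k) ⟩
  suc j * (suc j ^ k * j)                 ≡⟨ *-assoc (suc j) (suc j ^ k) j ⟨
  suc j * suc j ^ k * j                   ∎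
  where
  open ≤-Reasoning
  lhs : ∀ j p k → j * p * suc (j + k) + p * k ≡ suc j * (p * (j + k))
  lhs = solve-∀

-- An explicit number of rounds after which the power of `j / suc j` is at most `1/m`, since
-- `1 + k/j ≥ m` once `k ≥ m * j`. The `suc` in the exponent serves `j = 0`, where `0 ^ 0 = 1`.
power-gap : ∀ m j → m * j ^ suc (m * j) ≤ suc j ^ suc (m * j)
power-gap m zero = ≤-trans (≤-reflexive (*-zeroʳ m)) z≤n
power-gap m j@(suc _) = *-cancelʳ-≤ (m * j ^ k) (suc j ^ k) j (begin
  m * j ^ k * j       ≡⟨ swap m (j ^ k) j ⟩
  j ^ k * (m * j)     ≤⟨ *-monoʳ-≤ (j ^ k) (≤-trans (n≤1+n (m * j)) (m≤n+m k j)) ⟩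
  j ^ k * (j + k)     ≤⟨ bernoulli j k ⟩
  suc j ^ k * j       ∎)
  where
  open ≤-Reasoning
  k = suc (m * j)
  swap : ∀ x y z → x * y * z ≡ y * (x * z)
  swap = solve-∀

-- After `k` contractions the relative error is at most `1/m`, and the remaining `n ∸ k * l`
-- coordinates double error and main term alike. The threshold depends on `l` and `m` alone, so `g`
-- may later vary with the polynomial and the subcube.
equidistribution : ∀ l m → Σ ℕ λ N → ∀ n → N ≤ n → ∀ g κ → (∀ s → window g (suc l) s ≡ κ) →
  ∀ s → m * (κ * 2 ^ n) ≤ m * (suc l * walk g n s) + κ * 2 ^ n
equidistribution l m = k * l , λ n N≤n g κ h s → let r = n ∸ k * l in begin
    m * (κ * 2 ^ n)                                        ≤⟨ *-monoʳ-≤ m (bound n N≤n g κ h s) ⟩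
    m * (suc l * walk g n s + 2 ^ r * (j ^ k * κ))         ≡⟨ expand m (suc l * walk g n s) (2 ^ r) (j ^ k) κ ⟩
    m * (suc l * walk g n s) + κ * (2 ^ r * (m * j ^ k))   ≤⟨ +-monoʳ-≤ _ (*-monoʳ-≤ κ (*-monoʳ-≤ (2 ^ r) gap)) ⟩
    m * (suc l * walk g n s) + κ * (2 ^ r * 2 ^ (k * l))   ≡⟨ cong (λ t → m * (suc l * walk g n s) + κ * t) (^-distribˡ-+-* 2 r (k * l)) ⟨
    m * (suc l * walk g n s) + κ * 2 ^ (r + k * l)         ≡⟨ cong (λ t → m * (suc l * walk g n s) + κ * 2 ^ t) (m∸n+n≡m N≤n) ⟩
    m * (suc l * walk g n s) + κ * 2 ^ n                   ∎
  where
  open ≤-Reasoning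
  j = offChain l
  k = suc (m * j)
  bound : ∀ n → k * l ≤ n → ∀ g κ (h : ∀ s → window g (suc l) s ≡ κ) →
    LowerBound g l κ h n (2 ^ (n ∸ k * l) * (j ^ k * κ))
  bound n N≤n g κ h = subst (λ t → LowerBound g l κ h t (2 ^ (n ∸ k * l) * (j ^ k * κ)))
    (m∸n+n≡m N≤n) (lowerBound-+ g l κ h (n ∸ k * l) (k * l) (j ^ k * κ) (lowerBound-iterate g l κ h k))
  expand : ∀ m w p q c → m * (w + p * (q * c)) ≡ m * w + c * (p * (m * q))
  expand = solve-∀
  suc-j≤ : suc j ≤ 2 ^ l
  suc-j≤ = ≤-trans (≤-trans (≤-reflexive (+-comm 1 j)) (+-monoʳ-≤ j (s≤s z≤n))) (≤-reflexive (offChain+suc l))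
  gap : m * j ^ k ≤ 2 ^ (k * l)
  gap = ≤-trans (power-gap m j) (≤-trans (^-monoˡ-≤ k suc-j≤)
    (≤-reflexive (trans (^-*-assoc 2 l k) (cong (2 ^_) (*-comm l k)))))

-- Ramsey's theorem for two-coloured `d`-sets

Monochromatic : ∀ {n} → ℕ → (Subset n → Bool) → Subset n → Bool → Set
Monochromatic d c S v = ∀ T → T ⊆ S → ∣ T ∣ ≡ d → c T ≡ v

HasMonochromatic : ∀ {n} → ℕ → (Subset n → Bool) → Subset n → ℕ → Bool → Set
HasMonochromatic {n} d c R a v = Σ (Subset n) λ S → S ⊆ R × a ≤ ∣ S ∣ × Monochromatic d c S v

RamseyNumber : ℕ → ℕ → ℕ → ℕ → Set
RamseyNumber d a b N = ∀ {n} (R : Subset n) → N ≤ ∣ R ∣ → (c : Subset n → Bool) →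
  HasMonochromatic d c R a false ⊎ HasMonochromatic d c R b true

emptyColour : ∀ {n} (c : Subset n → Bool) → Σ Bool λ v → ∀ S → Monochromatic 0 c S v
emptyColour {zero} c = c [] , λ { _ [] _ _ → refl }
emptyColour {suc n} c with emptyColour (c ∘ (false ∷_))
... | v , h = v , λ { (_ ∷ S) (false ∷ T) T⊆S e → h S T (drop-∷-⊆ T⊆S) e }

monochromatic-∷ : ∀ {n d v} {c : Subset (suc n) → Bool} {S : Subset n} →
  Monochromatic d (c ∘ (true ∷_)) S v → Monochromatic (suc d) (c ∘ (false ∷_)) S v →
  Monochromatic (suc d) c (true ∷ S) v
monochromatic-∷ h₁ h₀ (true ∷ T) T⊆S e = h₁ T (drop-∷-⊆ T⊆S) (suc-injective e)
monochromatic-∷ h₁ h₀ (false ∷ T) T⊆S e = h₀ T (drop-∷-⊆ T⊆S) e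

hasMonochromatic-out : ∀ {n d a v s} {c : Subset (suc n) → Bool} {R : Subset n} →
  HasMonochromatic d (c ∘ (false ∷_)) R a v → HasMonochromatic d c (s ∷ R) a v
hasMonochromatic-out {c = c} (S , S⊆R , a≤ , h) = false ∷ S , out⊆ S⊆R , a≤ ,
  λ { (false ∷ T) T⊆S e → h T (drop-∷-⊆ T⊆S) e
    ; (true ∷ T) T⊆S e → contradiction (T⊆S here) λ () }

ramsey-empty : ∀ {n d} (c : Subset n → Bool) R v → HasMonochromatic (suc d) c R 0 v
ramsey-empty {zero} c [] v = [] , ⊆-refl , z≤n , λ { [] _ () }
ramsey-empty {suc n} c (s ∷ R) v = hasMonochromatic-out (ramsey-empty (c ∘ (false ∷_)) R v)

-- Ramsey's induction on the first vertex of `R`: `r` gives a set on which the link colouring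
-- `c ∘ (true ∷_)` is constant, and inside it `r₁` or `r₂` is applied to `c` itself. A set of the
-- link's colour is enlarged by the vertex; one of the other colour is already large enough.
ramsey-step : ∀ {d a b N₁ N₂ N} → RamseyNumber (suc d) a (suc b) N₁ →
  RamseyNumber (suc d) (suc a) b N₂ → RamseyNumber d N₁ N₂ N →
  RamseyNumber (suc d) (suc a) (suc b) (suc N)
ramsey-step r₁ r₂ r (false ∷ R) N≤ c with ramsey-step r₁ r₂ r R N≤ (c ∘ (false ∷_))
... | inj₁ m = inj₁ (hasMonochromatic-out m)
... | inj₂ m = inj₂ (hasMonochromatic-out m)
ramsey-step r₁ r₂ r (true ∷ R) (s≤s N≤) c with r R N≤ (c ∘ (true ∷_))
... | inj₁ (S , S⊆R , N₁≤ , link) with r₁ S N₁≤ (c ∘ (false ∷_))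
...   | inj₁ (U , U⊆S , a≤ , h) = inj₁ (true ∷ U , in⊆in (⊆-trans U⊆S S⊆R) , s≤s a≤ ,
          monochromatic-∷ {c = c} (λ T T⊆U → link T (⊆-trans T⊆U U⊆S)) h)
...   | inj₂ (U , U⊆S , m) = inj₂ (hasMonochromatic-out (U , ⊆-trans U⊆S S⊆R , m))
ramsey-step r₁ r₂ r (true ∷ R) (s≤s N≤) c | inj₂ (S , S⊆R , N₂≤ , link) with r₂ S N₂≤ (c ∘ (false ∷_))
...   | inj₂ (U , U⊆S , a≤ , h) = inj₂ (true ∷ U , in⊆in (⊆-trans U⊆S S⊆R) , s≤s a≤ ,
          monochromatic-∷ {c = c} (λ T T⊆U → link T (⊆-trans T⊆U U⊆S)) h)
...   | inj₁ (U , U⊆S , m) = inj₁ (hasMonochromatic-out (U , ⊆-trans U⊆S S⊆R , m))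

ramsey : ∀ d a b → Σ ℕ (RamseyNumber d a b)
ramsey zero a b = a ⊔ b , λ R N≤ c → case-colour R N≤ c (emptyColour c)
  where
  case-colour : ∀ {n} (R : Subset n) → a ⊔ b ≤ ∣ R ∣ → (c : Subset n → Bool) →
    (Σ Bool λ v → ∀ S → Monochromatic 0 c S v) →
    HasMonochromatic 0 c R a false ⊎ HasMonochromatic 0 c R b true
  case-colour R N≤ c (false , h) = inj₁ (R , ⊆-refl , m⊔n≤o⇒m≤o a b N≤ , h R)
  case-colour R N≤ c (true , h) = inj₂ (R , ⊆-refl , m⊔n≤o⇒n≤o a b N≤ , h R)
ramsey (suc d) zero b = 0 , λ R _ c → inj₁ (ramsey-empty c R false)
ramsey (suc d) (suc a) zero = 0 , λ R _ c → inj₂ (ramsey-empty c R true)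
ramsey (suc d) (suc a) (suc b) with ramsey (suc d) a (suc b) | ramsey (suc d) (suc a) b
... | N₁ , r₁ | N₂ , r₂ with ramsey d N₁ N₂
...   | N , r = suc N , ramsey-step r₁ r₂ r

-- Sums over the cube and over subcubes

cubeSum : ∀ {n} → (Point n → ℕ) → ℕ
cubeSum {zero} g = g []
cubeSum {suc n} g = cubeSum (g ∘ (false ∷_)) + cubeSum (g ∘ (true ∷_))

cubeSum-cong : ∀ {n} {g h : Point n → ℕ} → (∀ x → g x ≡ h x) → cubeSum g ≡ cubeSum h
cubeSum-cong {zero} e = e []
cubeSum-cong {suc n} e = cong₂ _+_ (cubeSum-cong (e ∘ (false ∷_))) (cubeSum-cong (e ∘ (true ∷_)))

cubeSum-+ : ∀ {n} (g h : Point n → ℕ) → cubeSum (λ x → g x + h x) ≡ cubeSum g + cubeSum h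
cubeSum-+ {zero} g h = refl
cubeSum-+ {suc n} g h = trans
  (cong₂ _+_ (cubeSum-+ (g ∘ (false ∷_)) (h ∘ (false ∷_))) (cubeSum-+ (g ∘ (true ∷_)) (h ∘ (true ∷_))))
  (+-interchange (cubeSum (g ∘ (false ∷_))) (cubeSum (h ∘ (false ∷_)))
    (cubeSum (g ∘ (true ∷_))) (cubeSum (h ∘ (true ∷_))))

cubeSum-weight : ∀ n g s → cubeSum {n} (λ x → g (∣ x ∣ + s)) ≡ walk g n s
cubeSum-weight zero g s = refl
cubeSum-weight (suc n) g s = cong₂ _+_ (cubeSum-weight n g s)
  (trans (cubeSum-cong {n} (λ x → cong g (sym (+-suc ∣ x ∣ s)))) (cubeSum-weight n g (suc s)))

ones : Bool → ℕ
ones b = if b then 1 else 0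

-- The coordinates of z in S are ignored.
merge : ∀ {n} (S : Subset n) → Point ∣ S ∣ → Point n → Point n
merge [] [] [] = []
merge (true ∷ S) (b ∷ y) (_ ∷ z) = b ∷ merge S y z
merge (false ∷ S) y (b ∷ z) = b ∷ merge S y z

weightOutside : ∀ {n} → Subset n → Point n → ℕ
weightOutside [] [] = 0
weightOutside (true ∷ S) (_ ∷ z) = weightOutside S z
weightOutside (false ∷ S) (b ∷ z) = ones b + weightOutside S z

weight-∷ : ∀ {n} b (x : Point n) → ∣ b ∷ x ∣ ≡ ones b + ∣ x ∣
weight-∷ true x = refl
weight-∷ false x = refl

weight-merge : ∀ {n} (S : Subset n) y z → ∣ merge S y z ∣ ≡ weightOutside S z + ∣ y ∣
weight-merge [] [] [] = refl
weight-merge (true ∷ S) (b ∷ y) (_ ∷ z) = begin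
  ∣ b ∷ merge S y z ∣                  ≡⟨ weight-∷ b (merge S y z) ⟩
  ones b + ∣ merge S y z ∣             ≡⟨ cong (ones b +_) (weight-merge S y z) ⟩
  ones b + (weightOutside S z + ∣ y ∣) ≡⟨ +-swap (ones b) (weightOutside S z) ∣ y ∣ ⟩
  weightOutside S z + (ones b + ∣ y ∣) ≡⟨ cong (weightOutside S z +_) (weight-∷ b y) ⟨
  weightOutside S z + ∣ b ∷ y ∣        ∎
  where
  open ≡-Reasoning
weight-merge (false ∷ S) y (b ∷ z) = begin
  ∣ b ∷ merge S y z ∣                  ≡⟨ weight-∷ b (merge S y z) ⟩
  ones b + ∣ merge S y z ∣             ≡⟨ cong (ones b +_) (weight-merge S y z) ⟩
  ones b + (weightOutside S z + ∣ y ∣) ≡⟨ +-assoc (ones b) _ _ ⟨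
  ones b + weightOutside S z + ∣ y ∣   ∎
  where open ≡-Reasoning

-- Averaging over the assignments outside `S`. A coordinate outside `S` splits the sum into two
-- halves bounded separately; one inside is folded into the summand, which doubles `D`.
cubeSum-restrict : ∀ {n} (S : Subset n) (g : Point n → ℕ) K D →
  (∀ z → K * cubeSum (λ y → g (merge S y z)) ≤ D * 2 ^ ∣ S ∣) → K * cubeSum g ≤ D * 2 ^ n
cubeSum-restrict [] g K D h = h []
cubeSum-restrict {suc n} (false ∷ S) g K D h = begin
  K * (cubeSum g₀ + cubeSum g₁)       ≡⟨ *-distribˡ-+ K _ _ ⟩
  K * cubeSum g₀ + K * cubeSum g₁     ≤⟨ +-mono-≤ (cubeSum-restrict S g₀ K D (h ∘ (false ∷_)))
                                                   (cubeSum-restrict S g₁ K D (h ∘ (true ∷_))) ⟩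
  D * 2 ^ n + D * 2 ^ n               ≡⟨ double D (2 ^ n) ⟩
  D * 2 ^ suc n                       ∎
  where
  open ≤-Reasoning
  g₀ g₁ : Point n → ℕ
  g₀ = g ∘ (false ∷_)
  g₁ = g ∘ (true ∷_)
cubeSum-restrict {suc n} (true ∷ S) g K D h = begin
  K * (cubeSum g₀ + cubeSum g₁)       ≡⟨ cong (K *_) (cubeSum-+ g₀ g₁) ⟨
  K * cubeSum (λ x → g₀ x + g₁ x)     ≤⟨ cubeSum-restrict S (λ x → g₀ x + g₁ x) K (D * 2) halves ⟩
  D * 2 * 2 ^ n                       ≡⟨ *-assoc D 2 _ ⟩
  D * 2 ^ suc n                       ∎
  where
  open ≤-Reasoning
  g₀ g₁ : Point n → ℕ
  g₀ = g ∘ (false ∷_)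
  g₁ = g ∘ (true ∷_)
  halves : ∀ z → K * cubeSum (λ y → g₀ (merge S y z) + g₁ (merge S y z)) ≤ D * 2 * 2 ^ ∣ S ∣
  halves z = begin
    K * cubeSum (λ y → g₀ (merge S y z) + g₁ (merge S y z)) ≡⟨ cong (K *_) (cubeSum-+ {∣ S ∣} _ _) ⟩
    K * cubeSum (λ y → g (merge (true ∷ S) y (false ∷ z)))  ≤⟨ h (false ∷ z) ⟩
    D * 2 ^ suc ∣ S ∣                                       ≡⟨ *-assoc D 2 _ ⟨
    D * 2 * 2 ^ ∣ S ∣                                       ∎

-- Polynomials over F₂ given by coefficients

evalF₂ : ∀ {n} → (Subset n → Bool) → Point n → Bool
evalF₂ {zero} c [] = c []
evalF₂ {suc n} c (b ∷ x) = evalF₂ (c ∘ (false ∷_)) x xor (b ∧ evalF₂ (c ∘ (true ∷_)) x)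

evalF₂-cong : ∀ {n} {c c′ : Subset n → Bool} → (∀ T → c T ≡ c′ T) → ∀ x → evalF₂ c x ≡ evalF₂ c′ x
evalF₂-cong e [] = e []
evalF₂-cong e (b ∷ x) = cong₂ (λ p q → p xor (b ∧ q)) (evalF₂-cong (e ∘ (false ∷_)) x) (evalF₂-cong (e ∘ (true ∷_)) x)

evalF₂-zero : ∀ {n} (x : Point n) → evalF₂ (λ _ → false) x ≡ false
evalF₂-zero [] = refl
evalF₂-zero (true ∷ x) rewrite evalF₂-zero x = refl
evalF₂-zero (false ∷ x) rewrite evalF₂-zero x = refl

xor-combine : ∀ b v p q r s →
  (p xor (v ∧ q)) xor (b ∧ (r xor (v ∧ s))) ≡ (p xor (b ∧ r)) xor (v ∧ (q xor (b ∧ s)))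
xor-combine false v p q r s rewrite xor-identityʳ p | xor-identityʳ q = xor-identityʳ _
xor-combine true false p q r s rewrite xor-identityʳ p | xor-identityʳ r = sym (xor-identityʳ _)
xor-combine true true p q r s = interchange xor-commutativeSemigroup p q r s
  where
  xor-commutativeSemigroup = CommutativeRing.+-commutativeSemigroup xor-∧-commutativeRing

evalF₂-linear : ∀ {n} v (c c′ : Subset n → Bool) x →
  evalF₂ (λ T → c T xor (v ∧ c′ T)) x ≡ evalF₂ c x xor (v ∧ evalF₂ c′ x)
evalF₂-linear v c c′ [] = refl
evalF₂-linear v c c′ (b ∷ x)
  rewrite evalF₂-linear v (c ∘ (false ∷_)) (c′ ∘ (false ∷_)) x
        | evalF₂-linear v (c ∘ (true ∷_)) (c′ ∘ (true ∷_)) x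
  = xor-combine b v (evalF₂ (c ∘ (false ∷_)) x) _ _ _

restrict : ∀ {n} (S : Subset n) → Point n → (Subset n → Bool) → Subset ∣ S ∣ → Bool
restrict [] [] c T = c T
restrict (true ∷ S) (_ ∷ z) c (t ∷ T) = restrict S z (c ∘ (t ∷_)) T
restrict (false ∷ S) (b ∷ z) c T = restrict S z (λ U → c (false ∷ U) xor (b ∧ c (true ∷ U))) T

evalF₂-restrict : ∀ {n} (S : Subset n) z c y → evalF₂ (restrict S z c) y ≡ evalF₂ c (merge S y z)
evalF₂-restrict [] [] c [] = refl
evalF₂-restrict (true ∷ S) (_ ∷ z) c (b ∷ y) = cong₂ (λ p q → p xor (b ∧ q))
  (evalF₂-restrict S z (c ∘ (false ∷_)) y) (evalF₂-restrict S z (c ∘ (true ∷_)) y)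
evalF₂-restrict (false ∷ S) (b ∷ z) c y = trans (evalF₂-restrict S z _ y)
  (evalF₂-linear b (c ∘ (false ∷_)) (c ∘ (true ∷_)) (merge S y z))

embed : ∀ {n} (S : Subset n) → Subset ∣ S ∣ → Subset n
embed [] [] = []
embed (true ∷ S) (t ∷ T) = t ∷ embed S T
embed (false ∷ S) T = false ∷ embed S T

embed-⊆ : ∀ {n} (S : Subset n) T → embed S T ⊆ S
embed-⊆ [] [] = ⊆-refl
embed-⊆ (true ∷ S) (true ∷ T) = in⊆in (embed-⊆ S T)
embed-⊆ (true ∷ S) (false ∷ T) = out⊆ (embed-⊆ S T)
embed-⊆ (false ∷ S) T = out⊆ (embed-⊆ S T)

∣embed∣ : ∀ {n} (S : Subset n) T → ∣ embed S T ∣ ≡ ∣ T ∣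
∣embed∣ [] [] = refl
∣embed∣ (true ∷ S) (true ∷ T) = cong suc (∣embed∣ S T)
∣embed∣ (true ∷ S) (false ∷ T) = ∣embed∣ S T
∣embed∣ (false ∷ S) T = ∣embed∣ S T

-- Substituting constants adds to a coefficient only coefficients of proper supersets, and these
-- vanish by hypothesis. So the top-degree coefficients survive restriction, and with them a Ramsey
-- colour.
restrict-top : ∀ {n} (S : Subset n) z c T → (∀ U → ∣ T ∣ < ∣ U ∣ → c U ≡ false) →
  restrict S z c T ≡ c (embed S T)
restrict-top [] [] c [] h = refl
restrict-top (true ∷ S) (_ ∷ z) c (true ∷ T) h = restrict-top S z (c ∘ (true ∷_)) T (λ U lt → h (true ∷ U) (s≤s lt))
restrict-top (true ∷ S) (_ ∷ z) c (false ∷ T) h = restrict-top S z (c ∘ (false ∷_)) T (h ∘ (false ∷_))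
restrict-top (false ∷ S) (b ∷ z) c T h = trans
  (restrict-top S z (λ U → c (false ∷ U) xor (b ∧ c (true ∷ U))) T
    (λ U lt → vanish b (h (false ∷ U) lt) (h (true ∷ U) (m≤n⇒m≤1+n lt))))
  (lower b (h (true ∷ embed S T) (s≤s (≤-reflexive (sym (∣embed∣ S T))))))
  where
  vanish : ∀ b {p q} → p ≡ false → q ≡ false → p xor (b ∧ q) ≡ false
  vanish false refl refl = refl
  vanish true refl refl = refl
  lower : ∀ b {p q} → q ≡ false → p xor (b ∧ q) ≡ p
  lower false refl = xor-identityʳ _
  lower true refl = xor-identityʳ _

parity : ℕ → Bool
parity zero = false
parity (suc n) = not (parity n)

parity-+ : ∀ m n → parity (m + n) ≡ parity m xor parity n
parity-+ zero n = refl
parity-+ (suc m) n = trans (cong not (parity-+ m n)) (not-distribˡ-xor (parity m) (parity n))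

ofSize : ∀ {n} → ℕ → Subset n → Bool
ofSize d T = ∣ T ∣ ≡ᵇ d

-- `ofSize d` is the elementary symmetric polynomial of degree `d`, which counts the `d`-subsets of
-- the support of `x`; splitting off a variable is Pascal's rule.
evalF₂-ofSize : ∀ {n} d (x : Point n) → evalF₂ (ofSize d) x ≡ parity (∣ x ∣ C d)
evalF₂-ofSize zero [] = refl
evalF₂-ofSize (suc d) [] = refl
evalF₂-ofSize d (false ∷ x) = trans (xor-identityʳ _) (evalF₂-ofSize d x)
evalF₂-ofSize zero (true ∷ x) = cong₂ _xor_ (evalF₂-ofSize 0 x) (evalF₂-zero x)
evalF₂-ofSize (suc d) (true ∷ x) = begin
  evalF₂ (ofSize (suc d)) x xor evalF₂ (ofSize d) x ≡⟨ cong₂ _xor_ (evalF₂-ofSize (suc d) x) (evalF₂-ofSize d x) ⟩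
  parity (w C suc d) xor parity (w C d)             ≡⟨ parity-+ (w C suc d) (w C d) ⟨
  parity (w C suc d + w C d)                        ≡⟨ cong parity (trans (+-comm (w C suc d) (w C d)) (nCk+nC[k+1]≡[n+1]C[k+1] w d)) ⟩
  parity (suc w C suc d)                            ∎
  where
  open ≡-Reasoning
  w = ∣ x ∣

-- Pascal's rule propagates the comparison of rows `K` and `0` to rows `K + w` and `w`, in the
-- columns below `D`. The relation is abstract because it is used both modulo 2 and modulo 8.
binomial-period : (_≈_ : ℕ → ℕ → Set) → (∀ {a b c d} → a ≈ b → c ≈ d → (a + c) ≈ (b + d)) →
  ∀ K D → (∀ {i} → i < D → (K C i) ≈ (0 C i)) → ∀ w {i} → i < D → ((K + w) C i) ≈ (w C i)
binomial-period _≈_ +-cong K D h zero {i} i<D = subst (λ t → (t C i) ≈ (0 C i)) (sym (+-identityʳ K)) (h i<D)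
binomial-period _≈_ +-cong K D h (suc w) {zero} i<D = h i<D
binomial-period _≈_ +-cong K D h (suc w) {suc i} i<D = subst₂ _≈_
  (trans (nCk+nC[k+1]≡[n+1]C[k+1] (K + w) i) (cong (_C suc i) (sym (+-suc K w))))
  (nCk+nC[k+1]≡[n+1]C[k+1] w i)
  (+-cong (binomial-period _≈_ +-cong K D h w (<⇒≤ i<D)) (binomial-period _≈_ +-cong K D h w i<D))

-- `16 C i` is even for `0 < i < 16`, checked by enumeration. The period fails at `d = 16`, where
-- the parity of `w C 16` is bit 4 of `w`.
parity-binomial-period : ∀ w {d} → d < 16 → parity ((16 + w) C d) ≡ parity (w C d)
parity-binomial-period = binomial-period (λ a b → parity a ≡ parity b)
  (λ {a} {b} {c} {d} p q → trans (parity-+ a c) (trans (cong₂ _xor_ p q) (sym (parity-+ b d))))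
  16 16 (toWitness {a? = allUpTo? (λ i → parity (16 C i) ≟ parity (0 C i)) 16} _)

-- Antiperiodic functions against low-degree polynomials

Antiperiodic : ℕ → (ℕ → Bool) → Set
Antiperiodic p f = ∀ v → f (p + v) ≡ not (f v)

ones-not : ∀ b → ones (not b) + ones b ≡ 1
ones-not true = refl
ones-not false = refl

window-+ : ∀ a q p s → window a (q + p) s ≡ window a p s + window a q (p + s)
window-+ a zero p s = sym (+-identityʳ _)
window-+ a (suc q) p s = begin
  window a (q + p) s + a (q + p + s)                   ≡⟨ cong₂ _+_ (window-+ a q p s) (cong a (+-assoc q p s)) ⟩
  window a p s + window a q (p + s) + a (q + (p + s))  ≡⟨ +-assoc (window a p s) _ _ ⟩
  window a p s + window a (suc q) (p + s)              ∎
  where open ≡-Reasoning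

-- The window splits into pairs `t`, `p + t`, and `f` is true at exactly one of each.
window-antiperiodic : ∀ p f → Antiperiodic p f → ∀ s → window (ones ∘ f) (p + p) s ≡ p
window-antiperiodic p f anti s = trans (window-+ (ones ∘ f) p p s) (pairs p)
  where
  pair : ∀ t → ones (f t) + ones (f (p + t)) ≡ 1
  pair t = trans (cong (λ b → ones (f t) + ones b) (anti t)) (trans (+-comm (ones (f t)) _) (ones-not (f t)))
  pairs : ∀ q → window (ones ∘ f) q s + window (ones ∘ f) q (p + s) ≡ q
  pairs zero = refl
  pairs (suc q) = begin
    window (ones ∘ f) (suc q) s + window (ones ∘ f) (suc q) (p + s)
      ≡⟨ +-interchange (window (ones ∘ f) q s) (ones (f (q + s))) (window (ones ∘ f) q (p + s)) (ones (f (q + (p + s)))) ⟩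
    window (ones ∘ f) q s + window (ones ∘ f) q (p + s) + (ones (f (q + s)) + ones (f (q + (p + s))))
      ≡⟨ cong₂ _+_ (pairs q) (trans (cong (λ t → ones (f (q + s)) + ones (f t)) (+-swap q p s)) (pair (q + s))) ⟩
    q + 1  ≡⟨ +-comm q 1 ⟩
    suc q  ∎
    where open ≡-Reasoning

cubeSum-one : ∀ n → cubeSum {n} (λ _ → 1) ≡ 2 ^ n
cubeSum-one zero = refl
cubeSum-one (suc n) = cong₂ _+_ (cubeSum-one n) (trans (cubeSum-one n) (sym (+-identityʳ _)))

cubeSum-weight₀ : ∀ n (g : ℕ → ℕ) → cubeSum {n} (λ x → g ∣ x ∣) ≡ walk g n 0
cubeSum-weight₀ n g = trans (cubeSum-cong {n} (λ x → cong g (sym (+-identityʳ ∣ x ∣)))) (cubeSum-weight n g 0)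

-- `equidistribution` bounds from below, so it is applied to `not ∘ f`, which is again antiperiodic,
-- and the count for `f` is the complement. The period is `suc p-1` so that the window length
-- `p + p` has the form `suc l`.
antiperiodic-balanced : ∀ p-1 m → Σ ℕ λ N → ∀ n → N ≤ n → ∀ f → Antiperiodic (suc p-1) f →
  2 * m * cubeSum {n} (λ x → ones (f ∣ x ∣)) ≤ (m + 2) * 2 ^ n
antiperiodic-balanced p-1 m = proj₁ equi , λ n N≤n f anti → bound n f
  (subst (λ Y → m * (p * 2 ^ n) ≤ m * ((p + p) * Y) + p * 2 ^ n) (sym (cubeSum-weight₀ n (ones ∘ not ∘ f)))
    (proj₂ equi n N≤n (ones ∘ not ∘ f) p (window-antiperiodic p (not ∘ f) (cong not ∘ anti)) 0))
  where
  p = suc p-1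
  equi = equidistribution (p-1 + p) m
  bound : ∀ n f → m * (p * 2 ^ n) ≤ m * ((p + p) * cubeSum {n} (λ x → ones (not (f ∣ x ∣)))) + p * 2 ^ n →
    2 * m * cubeSum {n} (λ x → ones (f ∣ x ∣)) ≤ (m + 2) * 2 ^ n
  bound n f h = +-cancelʳ-≤ (m * T) (2 * m * X) ((m + 2) * T) (begin
    2 * m * X + m * T                 ≤⟨ +-monoʳ-≤ (2 * m * X) (*-cancelˡ-≤ p (subst₂ _≤_ (lhs m p T) (rhs m p Y T) h)) ⟩
    -- The estimate so far amounts to `1/2 + 1/(2m)`; one more `T` rounds it up to the `1/2 + 1/m`
    -- of the theorem.
    2 * m * X + (2 * m * Y + T)       ≤⟨ +-monoʳ-≤ (2 * m * X) (+-monoʳ-≤ (2 * m * Y) (m≤m+n T T)) ⟩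
    2 * m * X + (2 * m * Y + (T + T)) ≡⟨ collect m X Y T ⟩
    2 * m * (Y + X) + (T + T)         ≡⟨ cong (λ t → 2 * m * t + (T + T)) total ⟩
    2 * m * T + (T + T)               ≡⟨ split m T ⟩
    (m + 2) * T + m * T               ∎)
    where
    open ≤-Reasoning
    T = 2 ^ n
    X = cubeSum {n} (λ x → ones (f ∣ x ∣))
    Y = cubeSum {n} (λ x → ones (not (f ∣ x ∣)))
    total : Y + X ≡ T
    total = trans (sym (cubeSum-+ {n} (λ x → ones (not (f ∣ x ∣))) (λ x → ones (f ∣ x ∣))))
      (trans (cubeSum-cong {n} (λ x → ones-not (f ∣ x ∣))) (cubeSum-one n))
    lhs : ∀ m p t → m * (p * t) ≡ p * (m * t)
    lhs = solve-∀
    rhs : ∀ m p y t → m * ((p + p) * y) + p * t ≡ p * (2 * m * y + t)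
    rhs = solve-∀
    collect : ∀ m x y t → 2 * m * x + (2 * m * y + (t + t)) ≡ 2 * m * (y + x) + (t + t)
    collect = solve-∀
    split : ∀ m t → 2 * m * t + (t + t) ≡ (m + 2) * t + m * t
    split = solve-∀

-- Induction on the strict degree bound `d`; at `d = 0` the polynomial vanishes. `N` is chosen
-- before `f` and `c` because each step replaces both by functions that depend on the subcube.
lowDegree-uncorrelated : ∀ d → d ≤ 16 → ∀ m → Σ ℕ λ N → ∀ n → N ≤ n →
  (c : Subset n → Bool) → (∀ T → d ≤ ∣ T ∣ → c T ≡ false) → ∀ f → Antiperiodic 16 f →
  2 * m * cubeSum (λ x → ones (f ∣ x ∣ xor evalF₂ c x)) ≤ (m + 2) * 2 ^ n
lowDegree-uncorrelated zero _ m = proj₁ (antiperiodic-balanced 15 m) , λ n N≤n c c≡0 f anti →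
  subst (λ t → 2 * m * t ≤ (m + 2) * 2 ^ n)
    (cubeSum-cong λ x → cong ones (sym (trans (cong (f ∣ x ∣ xor_) (trans (evalF₂-cong (λ T → c≡0 T z≤n) x) (evalF₂-zero x))) (xor-identityʳ _))))
    (proj₂ (antiperiodic-balanced 15 m) n N≤n f anti)
lowDegree-uncorrelated (suc d) d<16 m with lowDegree-uncorrelated d (<⇒≤ d<16) m
... | N , ih = proj₁ (ramsey d N N) , λ n N≤n c c≡0 f anti →
    pick n c c≡0 f anti (proj₂ (ramsey d N N) ⊤ (subst (proj₁ (ramsey d N N) ≤_) (sym (∣⊤∣≡n n)) N≤n) c)
  where
  module _ (n : ℕ) (c : Subset n → Bool) (c≡0 : ∀ T → suc d ≤ ∣ T ∣ → c T ≡ false)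
           (f : ℕ → Bool) (anti : Antiperiodic 16 f) where
    onSubcube : ∀ S v → N ≤ ∣ S ∣ → Monochromatic d c S v → ∀ z →
      2 * m * cubeSum (λ y → ones (f ∣ merge S y z ∣ xor evalF₂ c (merge S y z))) ≤ (m + 2) * 2 ^ ∣ S ∣
    onSubcube S v N≤ mono z = subst (λ t → 2 * m * t ≤ (m + 2) * 2 ^ ∣ S ∣)
      (cubeSum-cong (cong ones ∘ sym ∘ reduce)) (ih ∣ S ∣ N≤ c′ c′≡0 f′ anti′)
      where
      k = weightOutside S z
      -- The degree-`d` part of the restricted polynomial is `v` times the symmetric one, and over
      -- F₂ adding it once more cancels it.
      c′ : Subset ∣ S ∣ → Bool
      c′ T = restrict S z c T xor (v ∧ ofSize d T)
      -- The same term is added to `f`, so the xor of the two is unchanged; `k` counts the ones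
      -- among the fixed coordinates.
      f′ : ℕ → Bool
      f′ w = f (k + w) xor (v ∧ parity (w C d))

      top : ∀ T → d ≤ ∣ T ∣ → restrict S z c T ≡ c (embed S T)
      top T d≤ = restrict-top S z c T (λ U lt → c≡0 U (≤-trans (s≤s d≤) lt))

      c′≡0 : ∀ T → d ≤ ∣ T ∣ → c′ T ≡ false
      c′≡0 T d≤ with ∣ T ∣ ℕ.≟ d
      ... | yes e = trans (cong₂ (λ p q → p xor (v ∧ q))
                (trans (top T d≤) (mono (embed S T) (embed-⊆ S T) (trans (∣embed∣ S T) e)))
                (trans (cong (_≡ᵇ d) e) (≡ᵇ-refl d)))
              (trans (cong (v xor_) (∧-identityʳ v)) (xor-same v))
        where
        ≡ᵇ-refl : ∀ k → (k ≡ᵇ k) ≡ true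
        ≡ᵇ-refl zero = refl
        ≡ᵇ-refl (suc k) = ≡ᵇ-refl k
      ... | no ne = trans (cong₂ (λ p q → p xor (v ∧ q))
                (trans (top T d≤) (c≡0 (embed S T) (subst (suc d ≤_) (sym (∣embed∣ S T)) (≤∧≢⇒< d≤ (ne ∘ sym)))))
                (≢⇒≡ᵇ-false ∣ T ∣ d ne))
              (∧-zeroʳ v)
        where
        ≢⇒≡ᵇ-false : ∀ j k → j ≢ k → (j ≡ᵇ k) ≡ false
        ≢⇒≡ᵇ-false zero zero ne = contradiction refl ne
        ≢⇒≡ᵇ-false zero (suc k) ne = refl
        ≢⇒≡ᵇ-false (suc j) zero ne = refl
        ≢⇒≡ᵇ-false (suc j) (suc k) ne = ≢⇒≡ᵇ-false j k (ne ∘ cong suc)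

      anti′ : Antiperiodic 16 f′
      anti′ w = begin
        f (k + (16 + w)) xor (v ∧ parity ((16 + w) C d))
          ≡⟨ cong₂ (λ t b → f t xor (v ∧ b)) (+-swap k 16 w) (parity-binomial-period w d<16) ⟩
        f (16 + (k + w)) xor (v ∧ parity (w C d))
          ≡⟨ cong (_xor (v ∧ parity (w C d))) (anti (k + w)) ⟩
        not (f (k + w)) xor (v ∧ parity (w C d))
          ≡⟨ not-distribˡ-xor (f (k + w)) _ ⟨
        not (f′ w) ∎
        where
        open ≡-Reasoning

      reduce : ∀ y → f ∣ merge S y z ∣ xor evalF₂ c (merge S y z) ≡ f′ ∣ y ∣ xor evalF₂ c′ y
      reduce y = begin
        f ∣ merge S y z ∣ xor evalF₂ c (merge S y z)
          ≡⟨ cong₂ (λ w b → f w xor b) (weight-merge S y z) (sym (evalF₂-restrict S z c y)) ⟩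
        f (k + ∣ y ∣) xor evalF₂ (restrict S z c) y
          ≡⟨ insert (f (k + ∣ y ∣)) (v ∧ b) (evalF₂ (restrict S z c) y) ⟩
        (f (k + ∣ y ∣) xor (v ∧ b)) xor (evalF₂ (restrict S z c) y xor (v ∧ b))
          ≡⟨ cong (λ t → f′ ∣ y ∣ xor (evalF₂ (restrict S z c) y xor (v ∧ t))) (evalF₂-ofSize d y) ⟨
        f′ ∣ y ∣ xor (evalF₂ (restrict S z c) y xor (v ∧ evalF₂ (ofSize d) y))
          ≡⟨ cong (f′ ∣ y ∣ xor_) (evalF₂-linear v (restrict S z c) (ofSize d) y) ⟨
        f′ ∣ y ∣ xor evalF₂ c′ y ∎
        where
        open ≡-Reasoning
        b = parity (∣ y ∣ C d)
        insert : ∀ p q r → p xor r ≡ (p xor q) xor (r xor q)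
        insert p false r rewrite xor-identityʳ p | xor-identityʳ r = refl
        insert false true false = refl
        insert false true true = refl
        insert true true false = refl
        insert true true true = refl

    finish : ∀ v → HasMonochromatic d c ⊤ N v →
      2 * m * cubeSum (λ x → ones (f ∣ x ∣ xor evalF₂ c x)) ≤ (m + 2) * 2 ^ n
    finish v (S , _ , N≤ , mono) = cubeSum-restrict S _ (2 * m) (m + 2) (onSubcube S v N≤ mono)

    pick : HasMonochromatic d c ⊤ N false ⊎ HasMonochromatic d c ⊤ N true →
      2 * m * cubeSum (λ x → ones (f ∣ x ∣ xor evalF₂ c x)) ≤ (m + 2) * 2 ^ n
    pick (inj₁ h) = finish false h
    pick (inj₂ h) = finish true h

-- From `agree` and `evalP` to cube sums and F₂-polynomials

sum-allPoints : ∀ {n} (g : Point n → ℕ) → sum (map g (allPoints n)) ≡ cubeSum g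
sum-allPoints {zero} g = +-identityʳ (g [])
sum-allPoints {suc n} g = begin
  sum (map g (allPoints (suc n)))                              ≡⟨ pairUp (allPoints n) ⟩
  sum (map (λ v → g (false ∷ v) + g (true ∷ v)) (allPoints n)) ≡⟨ sum-allPoints {n} _ ⟩
  cubeSum (λ v → g (false ∷ v) + g (true ∷ v))                 ≡⟨ cubeSum-+ (g ∘ (false ∷_)) (g ∘ (true ∷_)) ⟩
  cubeSum g                                                    ∎
  where
  open ≡-Reasoning
  pairUp : ∀ xs → sum (map g (concatMap (λ v → (false ∷ v) ∷ (true ∷ v) ∷ []) xs))
    ≡ sum (map (λ v → g (false ∷ v) + g (true ∷ v)) xs)
  pairUp [] = refl
  pairUp (v ∷ xs) = trans (sym (+-assoc (g (false ∷ v)) (g (true ∷ v)) _))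
    (cong (g (false ∷ v) + g (true ∷ v) +_) (pairUp xs))

agree≡cubeSum : ∀ {n d} (F : BoolFun n) (P : NCPoly n d) →
  agree F P ≡ cubeSum (λ x → ones (eqT (boolT (F x)) (evalP P x)))
agree≡cubeSum {n} F P = trans (length-filter (λ x → eqT (boolT (F x)) (evalP P x)) (allPoints n)) (sum-allPoints {n} _)
  where
  length-filter : ∀ {A : Set} (p : A → Bool) xs → length (filterᵇ p xs) ≡ sum (map (ones ∘ p) xs)
  length-filter p [] = refl
  length-filter p (x ∷ xs) with p x
  ... | true = cong suc (length-filter p xs)
  ... | false = length-filter p xs

-- The integer value before reduction: classical polynomials need its parity (`parity-monomials`),
-- the polynomial of depth 3 its exact binomial value (`monomials-ofSize`).
monomials : ∀ {n} → (Subset n → Bool) → Point n → ℕ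
monomials c x = cubeSum (λ S → if c S then mono S x else 0)

monomials-∷ : ∀ {n} c b (x : Point n) →
  monomials c (b ∷ x) ≡ monomials (c ∘ (false ∷_)) x + (if b then monomials (c ∘ (true ∷_)) x else 0)
monomials-∷ {n} c b x = cong₂ _+_
  (cubeSum-cong (λ S → cong (if c (false ∷ S) then_else 0) (+-identityʳ (mono S x))))
  (scale b)
  where
  vanish : ∀ S → (if c (true ∷ S) then 0 else 0) ≡ 0
  vanish S with c (true ∷ S)
  ... | true = refl
  ... | false = refl
  cubeSum-zero : ∀ n → cubeSum {n} (λ _ → 0) ≡ 0
  cubeSum-zero zero = refl
  cubeSum-zero (suc n) = cong₂ _+_ (cubeSum-zero n) (cubeSum-zero n)
  scale : ∀ b → cubeSum (λ S → if c (true ∷ S) then (if b then 1 else 0) * mono S x else 0)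
    ≡ (if b then monomials (c ∘ (true ∷_)) x else 0)
  scale true = cubeSum-cong (λ S → cong (if c (true ∷ S) then_else 0) (+-identityʳ (mono S x)))
  scale false = trans (cubeSum-cong vanish) (cubeSum-zero n)

parity-monomials : ∀ {n} c (x : Point n) → parity (monomials c x) ≡ evalF₂ c x
parity-monomials c [] with c []
... | true = refl
... | false = refl
parity-monomials c (b ∷ x) = begin
  parity (monomials c (b ∷ x))                                  ≡⟨ cong parity (monomials-∷ c b x) ⟩
  parity (monomials c₀ x + (if b then monomials c₁ x else 0))   ≡⟨ parity-+ (monomials c₀ x) _ ⟩
  parity (monomials c₀ x) xor parity (if b then monomials c₁ x else 0)
    ≡⟨ cong₂ _xor_ (parity-monomials c₀ x) (parity-if b) ⟩
  evalF₂ c (b ∷ x)                                              ∎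
  where
  open ≡-Reasoning
  c₀ = c ∘ (false ∷_)
  c₁ = c ∘ (true ∷_)
  parity-if : ∀ b → parity (if b then monomials c₁ x else 0) ≡ b ∧ evalF₂ c₁ x
  parity-if true = parity-monomials c₁ x
  parity-if false = refl

monomials-none : ∀ {n} (x : Point n) → monomials (λ _ → false) x ≡ 0
monomials-none [] = refl
monomials-none (true ∷ x) = trans (monomials-∷ (λ _ → false) true x) (cong₂ _+_ (monomials-none x) (monomials-none x))
monomials-none (false ∷ x) = trans (monomials-∷ (λ _ → false) false x) (cong₂ _+_ (monomials-none x) refl)

monomials-ofSize : ∀ {n} d (x : Point n) → monomials (ofSize d) x ≡ ∣ x ∣ C d
monomials-ofSize zero [] = refl
monomials-ofSize (suc d) [] = refl
monomials-ofSize d (false ∷ x) = trans (monomials-∷ (ofSize d) false x)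
  (trans (+-identityʳ _) (monomials-ofSize d x))
monomials-ofSize zero (true ∷ x) = trans (monomials-∷ (ofSize 0) true x)
  (cong₂ _+_ (monomials-ofSize 0 x) (monomials-none x))
monomials-ofSize (suc d) (true ∷ x) = begin
  monomials (ofSize (suc d)) (true ∷ x)                    ≡⟨ monomials-∷ (ofSize (suc d)) true x ⟩
  monomials (ofSize (suc d)) x + monomials (ofSize d) x    ≡⟨ cong₂ _+_ (monomials-ofSize (suc d) x) (monomials-ofSize d x) ⟩
  w C suc d + w C d                                        ≡⟨ +-comm (w C suc d) (w C d) ⟩
  w C d + w C suc d                                        ≡⟨ nCk+nC[k+1]≡[n+1]C[k+1] w d ⟩
  suc w C suc d                                            ∎
  where
  open ≡-Reasoning
  w = ∣ x ∣

-- The numerator in `evalP` with the fields as separate arguments, so that the depth can be split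
-- into cases.
numerator : ∀ {n} → ℕ → ℕ → (Subset n → ℕ → Bool) → Point n → ℕ
numerator {n} depth shift coeff x = shift + sum (map (λ S → sum (map (λ k →
  if coeff S k then mono S x * 2 ^ (depth ∸ k) else 0) (map suc (upTo depth)))) (allPoints n))

numerator-depth0 : ∀ {n} s (c : Subset n → ℕ → Bool) x → numerator 0 s c x ≡ s
numerator-depth0 {n} s c x = trans (cong (s +_) (zeros (allPoints n))) (+-identityʳ s)
  where
  zeros : ∀ {A : Set} (xs : List A) → sum (map (λ _ → 0) xs) ≡ 0
  zeros [] = refl
  zeros (_ ∷ xs) = zeros xs

numerator-depth1 : ∀ {n} s (c : Subset n → ℕ → Bool) x → numerator 1 s c x ≡ s + monomials (λ S → c S 1) x
numerator-depth1 {n} s c x = cong (s +_) (trans (sum-allPoints {n} _)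
  (cubeSum-cong λ S → trans (+-identityʳ _) (cong (if c S 1 then_else 0) (*-identityʳ (mono S x)))))

eqT-depth1 : ∀ b a → eqT (boolT b) (a , 1) ≡ not b xor parity a
eqT-depth1 true zero = refl
eqT-depth1 false zero = refl
eqT-depth1 true (suc zero) = refl
eqT-depth1 false (suc zero) = refl
-- `(2 + a) * 2 % 4` computes to `a * 2 % 4`, so the comparison has period 2 in `a`.
eqT-depth1 b (suc (suc a)) = trans (eqT-depth1 b a) (cong (not b xor_) (sym (not-involutive (parity a))))

eqT-classical : ∀ {n} D s (c : Subset n → ℕ → Bool) → D ≤ 1 → s < 2 ^ D →
  (∀ S k → c S k ≡ true → 1 ≤ k × k ≤ D) → ∀ b x →
  eqT (boolT b) (numerator D s c x , D) ≡ (not b xor parity s) xor evalF₂ (λ S → c S 1) x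
eqT-classical zero (suc s) c _ (s≤s ()) range b x
-- Depth 0 leaves only the zero polynomial: the shift is below `2 ^ 0` and no level is in range.
eqT-classical zero zero c _ _ range b x = begin
  eqT (boolT b) (numerator 0 0 c x , 0)                     ≡⟨ cong (λ a → eqT (boolT b) (a , 0)) (numerator-depth0 0 c x) ⟩
  eqT (boolT b) (0 , 0)                                     ≡⟨ zero-case b ⟩
  (not b xor false) xor false                               ≡⟨ cong ((not b xor false) xor_) (trans (evalF₂-cong vanish x) (evalF₂-zero x)) ⟨
  (not b xor false) xor evalF₂ (λ S → c S 1) x              ∎
  where
  open ≡-Reasoning
  vanish : ∀ S → c S 1 ≡ false
  vanish S = ¬-not (λ e → contradiction (proj₂ (range S 1 e)) λ ())
  zero-case : ∀ b → eqT (boolT b) (0 , 0) ≡ (not b xor false) xor false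
  zero-case true = refl
  zero-case false = refl
eqT-classical (suc zero) s c _ _ range b x = begin
  eqT (boolT b) (numerator 1 s c x , 1)                     ≡⟨ eqT-depth1 b (numerator 1 s c x) ⟩
  not b xor parity (numerator 1 s c x)                      ≡⟨ cong (λ t → not b xor parity t) (numerator-depth1 s c x) ⟩
  not b xor parity (s + monomials (λ S → c S 1) x)          ≡⟨ cong (not b xor_) (parity-+ s _) ⟩
  not b xor (parity s xor parity (monomials (λ S → c S 1) x)) ≡⟨ xor-assoc (not b) (parity s) _ ⟨
  (not b xor parity s) xor parity (monomials (λ S → c S 1) x) ≡⟨ cong ((not b xor parity s) xor_) (parity-monomials (λ S → c S 1) x) ⟩
  (not b xor parity s) xor evalF₂ (λ S → c S 1) x           ∎
  where open ≡-Reasoning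
eqT-classical (suc (suc D)) s c (s≤s ()) _ range b x

-- The function `F` and the classical bound

bit₄ : ℕ → Bool
bit₄ w = parity (w / 16)

bit₄-antiperiodic : Antiperiodic 16 bit₄
bit₄-antiperiodic w = cong parity (trans (m/n≡1+[m∸n]/n {16 + w} (m≤m+n 16 w)) (cong (λ t → suc (t / 16)) (m+n∸m≡n 16 w)))

F : ∀ n → BoolFun n
F n x = bit₄ ∣ x ∣

-- By `eqT-classical`, agreement is the xor of `not (F n x)`, the parity of the shift and an
-- F₂-polynomial. The first two together are still antiperiodic in the weight, and degree at most 14
-- is the strict bound 15.
classical-bound : ∀ m → Σ ℕ λ N → ∀ n → N ≤ n → (P : NCPoly n 14) → Classical P →
  2 * m * agree (F n) P ≤ (m + 2) * 2 ^ n
classical-bound m = proj₁ (lowDegree-uncorrelated 15 15≤16 m) , λ n N≤n P classical →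
  subst (λ t → 2 * m * t ≤ (m + 2) * 2 ^ n)
    (sym (trans (agree≡cubeSum (F n) P) (cubeSum-cong (λ x → cong ones
      (eqT-classical (depth P) (shift P) (coeff P) classical (shift< P) (coeffRange P) (F n x) x)))))
    (proj₂ (lowDegree-uncorrelated 15 15≤16 m) n N≤n (λ S → coeff P S 1)
      (λ S 15≤ → ¬-not (λ e → <⇒≱ 15≤ (≤-trans (m≤m+n ∣ S ∣ 0) (coeffDeg P S 1 e))))
      (λ w → not (bit₄ w) xor parity (shift P))
      (λ w → trans (cong (λ b → not b xor parity (shift P)) (bit₄-antiperiodic w))
                   (sym (not-distribˡ-xor (not (bit₄ w)) (parity (shift P))))))
  where
  15≤16 : 15 ≤ 16
  15≤16 = n≤1+n 15

-- The non-classical polynomial and its agreement with `F`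

subsetOfSize : ∀ k n → k ≤ n → Σ (Subset n) λ S → ofSize k S ≡ true
subsetOfSize zero zero _ = [] , refl
subsetOfSize zero (suc n) _ with subsetOfSize zero n z≤n
... | S , e = false ∷ S , e
subsetOfSize (suc k) (suc n) (s≤s k≤n) with subsetOfSize k n k≤n
... | S , e = true ∷ S , e

∧-true : ∀ p q → p ∧ q ≡ true → p ≡ true × q ≡ true
∧-true true true _ = refl , refl

≡ᵇ-true : ∀ m n → (m ≡ᵇ n) ≡ true → m ≡ n
≡ᵇ-true zero zero _ = refl
≡ᵇ-true (suc m) (suc n) e = cong suc (≡ᵇ-true m n e)

-- The elementary symmetric polynomial of degree 12 divided by 8; level 3 adds 2 to the degree,
-- giving 14. The bound `12 ≤ n` supplies the nonzero coefficient that `depthExact` asks for.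
binomialEighth : ∀ n → 12 ≤ n → NCPoly n 14
binomialEighth n 12≤n = record
  { depth = 3
  ; shift = 0
  ; shift< = s≤s z≤n
  ; coeff = λ S k → ofSize 12 S ∧ (k ≡ᵇ 3)
  ; coeffRange = λ S k e → subst (λ k → 1 ≤ k × k ≤ 3) (sym (level S k e)) (s≤s z≤n , ≤-refl)
  ; coeffDeg = λ S k e → ≤-reflexive (cong₂ (λ s k → s + (k ∸ 1))
      (≡ᵇ-true ∣ S ∣ 12 (proj₁ (∧-true (ofSize 12 S) (k ≡ᵇ 3) e))) (level S k e))
  ; depthExact = inj₂ (proj₁ S₁₂ , cong (_∧ true) (proj₂ S₁₂))
  }
  where
  S₁₂ = subsetOfSize 12 n 12≤n
  level : ∀ S k → ofSize 12 S ∧ (k ≡ᵇ 3) ≡ true → k ≡ 3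
  level S k e = ≡ᵇ-true k 3 (proj₂ (∧-true (ofSize 12 S) (k ≡ᵇ 3) e))

evalP-binomialEighth : ∀ n 12≤n (x : Point n) → evalP (binomialEighth n 12≤n) x ≡ (∣ x ∣ C 12 , 3)
evalP-binomialEighth n 12≤n x = cong (_, 3) (trans (sum-allPoints {n} _)
  (trans (cubeSum-cong (λ S → level₃ (ofSize 12 S) (mono S x))) (monomials-ofSize 12 x)))
  where
  level₃ : ∀ b u → sum (map (λ k → if b ∧ (k ≡ᵇ 3) then u * 2 ^ (3 ∸ k) else 0) (1 ∷ 2 ∷ 3 ∷ [])) ≡ (if b then u else 0)
  level₃ true u = trans (+-identityʳ (u * 1)) (*-identityʳ u)
  level₃ false u = refl

matches : ℕ → Bool
matches w = eqT (boolT (bit₄ w)) (w C 12 , 3)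

eqT-depth3 : ∀ b a a′ → a % 8 ≡ a′ % 8 → eqT (boolT b) (a , 3) ≡ eqT (boolT b) (a′ , 3)
eqT-depth3 b a a′ e = cong (ones b * 8 % 16 ≡ᵇ_)
  (trans (sym (m%n*o≡m*o%[n*o] a 8 2)) (trans (cong (_* 2) e) (m%n*o≡m*o%[n*o] a′ 8 2)))

matches-cong : ∀ v w → bit₄ v ≡ bit₄ w → (v C 12) % 8 ≡ (w C 12) % 8 → matches v ≡ matches w
matches-cong v w e₁ e₂ = trans (cong (λ b → eqT (boolT b) (v C 12 , 3)) e₁) (eqT-depth3 (bit₄ w) (v C 12) (w C 12) e₂)

bit₄-periodic : ∀ w → bit₄ (64 + w) ≡ bit₄ w
bit₄-periodic w = trans (twice (32 + w)) (twice w)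
  where
  twice : ∀ w → bit₄ (32 + w) ≡ bit₄ w
  twice w = trans (bit₄-antiperiodic (16 + w)) (trans (cong not (bit₄-antiperiodic w)) (not-involutive (bit₄ w)))

-- For `0 < i < 13` the exponent of 2 in `64 C i` is 6 minus that in `i`, hence at least 3; here the
-- cases are enumerated.
binomial-mod8-periodic : ∀ w {i} → i < 13 → ((64 + w) C i) % 8 ≡ (w C i) % 8
binomial-mod8-periodic = binomial-period (λ a b → a % 8 ≡ b % 8)
  (λ {a} {b} {c} {d} p q →
    trans (%-distribˡ-+ a c 8) (trans (cong₂ (λ u v → (u + v) % 8) p q) (sym (%-distribˡ-+ b d 8))))
  64 13 (toWitness {a? = allUpTo? (λ i → (64 C i) % 8 ℕ.≟ (0 C i) % 8) 13} _)

matches-periodic : ∀ w → matches (64 + w) ≡ matches w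
matches-periodic w = matches-cong (64 + w) w (bit₄-periodic w) (binomial-mod8-periodic w ≤-refl)

window-periodic : ∀ a l → (∀ w → a (l + w) ≡ a w) → ∀ s → window a l s ≡ window a l 0
window-periodic a l period zero = refl
window-periodic a l period (suc s) = trans (+-cancelʳ-≡ (a s) _ _ (trans (slide l) (cong (window a l s +_) (period s))))
  (window-periodic a l period s)
  where
  slide : ∀ l → window a l (suc s) + a s ≡ window a l s + a (l + s)
  slide zero = refl
  slide (suc l) = begin
    window a l (suc s) + a (l + suc s) + a s   ≡⟨ swapʳ (window a l (suc s)) (a (l + suc s)) (a s) ⟩
    window a l (suc s) + a s + a (l + suc s)   ≡⟨ cong₂ _+_ (slide l) (cong a (+-suc l s)) ⟩
    window a l s + a (l + s) + a (suc l + s)   ∎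
    where
    open ≡-Reasoning
    swapʳ : ∀ u v w → u + v + w ≡ u + w + v
    swapʳ = solve-∀

window-const : ∀ (f : ℕ → Bool) l κ → (∀ w → f (l + w) ≡ f w) → window (ones ∘ f) l 0 ≡ κ →
  ∀ s → window (ones ∘ f) l s ≡ κ
window-const f l κ period e s = trans (window-periodic (ones ∘ f) l (λ w → cong ones (period w)) s) e

-- Writing w = 16 q + 4 r + i with r, i < 4, the matching w are those with r even,
-- and those with r = 1 and 4 ∣ q: density 1/2 + 1/16.
window-matches : ∀ s → window (ones ∘ matches) 64 s ≡ 36
window-matches = window-const matches 64 36 matches-periodic refl

-- Equidistribution with `m = suc κ` loses at most one unit of `2 ^ n`, which lowers `suc κ` to `κ`.
density-lower : ∀ l κ → Σ ℕ λ N → ∀ n → N ≤ n → ∀ f → (∀ s → window (ones ∘ f) (suc l) s ≡ suc κ) →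
  κ * 2 ^ n ≤ suc l * cubeSum {n} (λ x → ones (f ∣ x ∣))
density-lower l κ = proj₁ equi , λ n N≤n f h → cancel (2 ^ n) (cubeSum {n} (λ x → ones (f ∣ x ∣)))
  (subst (λ A → suc κ * (suc κ * 2 ^ n) ≤ suc κ * (suc l * A) + suc κ * 2 ^ n)
    (sym (cubeSum-weight₀ n (ones ∘ f))) (proj₂ equi n N≤n (ones ∘ f) (suc κ) h 0))
  where
  equi = equidistribution l (suc κ)
  cancel : ∀ T A → suc κ * (suc κ * T) ≤ suc κ * (suc l * A) + suc κ * T → κ * T ≤ suc l * A
  cancel T A h = +-cancelˡ-≤ T (κ * T) (suc l * A) (subst (suc κ * T ≤_) (+-comm (suc l * A) T)
    (*-cancelˡ-≤ (suc κ) (subst (suc κ * (suc κ * T) ≤_) (sym (*-distribˡ-+ (suc κ) (suc l * A) T)) h)))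

agree-binomialEighth : ∀ n 12≤n →
  agree (F n) (binomialEighth n 12≤n) ≡ cubeSum {n} (λ x → ones (matches ∣ x ∣))
agree-binomialEighth n 12≤n = trans (agree≡cubeSum (F n) (binomialEighth n 12≤n))
  (cubeSum-cong (λ x → cong (λ v → ones (eqT (boolT (F n x)) v)) (evalP-binomialEighth n 12≤n x)))

matches-density : Σ ℕ λ N → ∀ n → N ≤ n → 35 * 2 ^ n ≤ 64 * cubeSum {n} (λ x → ones (matches ∣ x ∣))
matches-density = proj₁ (density-lower 63 35) , λ n N≤n → proj₂ (density-lower 63 35) n N≤n matches window-matches

-- For `m = 32` the target is `1/2 + 1/32 = 34/64`, below the density 35/64 that remains of 36/64
-- after the equidistribution loss. The 12 added to the threshold makes a 12-subset available.
nonclassical-bound : (Σ ℕ λ N → ∀ n → N ≤ n → 35 * 2 ^ n ≤ 64 * cubeSum {n} (λ x → ones (matches ∣ x ∣))) →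
  Σ ℕ λ N → ∀ n → N ≤ n → Σ (NCPoly n 14) λ P′ → (32 + 2) * 2 ^ n ≤ 2 * 32 * agree (F n) P′
nonclassical-bound (N , density) = N + 12 , λ n N≤n → let 12≤n = m+n≤o⇒n≤o N N≤n in
  binomialEighth n 12≤n , (begin
    34 * 2 ^ n                                          ≤⟨ *-monoˡ-≤ (2 ^ n) (n≤1+n 34) ⟩
    35 * 2 ^ n                                          ≤⟨ density n (m+n≤o⇒m≤o N N≤n) ⟩
    64 * cubeSum {n} (λ x → ones (matches ∣ x ∣))       ≡⟨ cong (64 *_) (agree-binomialEighth n 12≤n) ⟨
    64 * agree (F n) (binomialEighth n 12≤n)            ∎)
  where open ≤-Reasoning

theorem5p7 : Σ ℕ λ d → 1 ≤ d × Σ ((n : ℕ) → BoolFun n) λ F →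
    ((m : ℕ) → 1 ≤ m → Σ ℕ λ N → (n : ℕ) → N ≤ n →
    (P : NCPoly n d) → Classical P →
    2 * m * agree (F n) P ≤ (m + 2) * 2 ^ n)
    × (Σ ℕ λ m → 1 ≤ m × Σ ℕ λ N → (n : ℕ) → N ≤ n →
    Σ (NCPoly n d) λ P' →
    (m + 2) * 2 ^ n ≤ 2 * m * agree (F n) P')
theorem5p7 = 14 , s≤s z≤n , F , (λ m _ → classical-bound m) , 32 , s≤s z≤n , nonclassical-bound matches-density
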